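{- Let $f:\mathbb{N}\to\mathbb{N}$ be a function such that for every $c\in\mathbb{N}$ and every $c$-coloring of $\{1,\ldots,f(c)\}$ there exist $x<y$ in $\{1,\ldots,f(c)\}$ such that $x$ and $y$ have the same color and $y-x$ is a perfect square. Then $f(c)\ge \Omega(c^{3.75})$; that is, there exist a constant $C>0$ and a $c_0$ such that $f(c)\ge C\,c^{3.75}$ for all $c\ge c_0$.
   Context: $\mathbb{N}=\{1,2,3,\ldots\}$. A $c$-coloring of $\{1,\ldots,N\}$ is a map $\{1,\ldots,N\}\to\{1,\ldots,c\}$. A perfect square is the square of an integer. Such a function $f$ is known to exist (by the polynomial van der Waerden theorem). -}

module Defs where

open import Data.Nat.Base as ℕ using (ℕ; NonZero)
open import Data.Integer.Base as ℤ using (ℤ; +_)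
open import Data.Rational.Base as ℚ using (ℚ; 0ℚ)
open import Data.Fin.Base as Fin using (Fin; toℕ)
open import Data.Product.Base using (∃-syntax; _×_)
open import Data.Sum.Base using (_⊎_)
open import Level using (0ℓ)
open import Relation.Binary.PropositionalEquality using (_≡_)
open import Relation.Unary using (Pred; _∈_)
open import Algebra.Definitions.RawSemiring ℚ.+-*-rawSemiring using () renaming (_^_ to _^ℚ_)

-- i : Fin N stands for the integer toℕ i + 1 of {1, …, N}, and likewise for
-- colours; the order and the differences are unaffected by this shift.
Coloring : ℕ → ℕ → Set
Coloring N c = Fin N → Fin c

PerfectSquare : ℤ → Set
PerfectSquare z = ∃[ k ] z ≡ k ℤ.* k

HasMonochromaticSquareDifference : ∀ {N c} → Coloring N c → Set
HasMonochromaticSquareDifference χ =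
  ∃[ x ] ∃[ y ] x Fin.< y × χ x ≡ χ y × PerfectSquare (+ toℕ y ℤ.- + toℕ x)

-- The positive integers are the n : ℕ with NonZero n, so f 0 is irrelevant.
-- For c ≥ 1 a c-coloring exists, so the condition itself forces f c ≥ 1.
ForcesSquareDifference : (ℕ → ℕ) → Set
ForcesSquareDifference f =
  ∀ c → .{{NonZero c}} → (χ : Coloring (f c) c) → HasMonochromaticSquareDifference χ

fromℕ : ℕ → ℚ
fromℕ n = + n ℚ./ 1

-- A real number is given by its lower Dedekind cut, the set of the rationals
-- strictly below it.
Cut : Set₁
Cut = Pred ℚ 0ℓ

-- The nonnegative real c^(p/q): a rational r ≥ 0 lies below it iff r^q < c^p.
-- The first disjunct adds the negative rationals, whose q-th power may be
-- large when q is even.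
infix 8 _^[_/_]
_^[_/_] : ℕ → ℕ → (q : ℕ) → .{{NonZero q}} → Cut
(c ^[ p / q ]) r = r ℚ.< 0ℚ ⊎ r ^ℚ q ℚ.< fromℕ (c ℕ.^ p)

-- y ≥ C · α for a real α and a rational C > 0: since α is the supremum of its
-- cut, this says that y bounds C · r for each r below α.
infix 4 _≥_·_
_≥_·_ : ℚ → ℚ → Cut → Set
y ≥ C · α = ∀ r → r ∈ α → C ℚ.* r ℚ.≤ y

{-# OPTIONS --safe #-}
-- Ruzsa's construction, in the lexicographic form that avoids a covering
-- argument.  Let R be a set of w residues modulo m, no two of which differ by
-- a square.  Given a good colouring u of {0, …, N − 1}, write
-- u(⌊x/m²⌋) = w a + j and colour x < m²N by the pair (a, (x + Rⱼ) mod m).  If x and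
-- x + k² have the same colour, then Rⱼ − Rⱼ′ ≡ k² modulo m, so j = j′, m ∣ k,
-- and ⌊x/m²⌋, ⌊x/m²⌋ + (k/m)² have the same colour under u.  Thus N grows by
-- the factor m² while the number of colours grows by about m/w.
-- For m = 205 and w = 12 one has (m/w)¹⁵ ≤ m⁸, that is, 205⁷ ≤ 12¹⁵.
module Submission where

open import Defs
open import Data.Nat.Base using (ℕ; _≤_)
open import Data.Rational.Base using (ℚ; 0ℚ; _<_)
open import Data.Product.Base using (∃-syntax; _×_)

open import Data.Nat.Base as ℕ using (zero; suc; _+_; _*_; _^_; _/_; _%_; NonZero; z≤n; s≤s)
open import Data.Nat.Properties as ℕ using ()
open import Data.Nat.DivMod
open import Data.Nat.Divisibility using (divides)
open import Data.Nat.Tactic.RingSolver using (solve-∀)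
open import Data.Integer.Base as ℤ using (+_)
import Data.Integer.Properties as ℤ
open import Data.Rational.Base as ℚ using ()
import Data.Rational.Properties as ℚ
open import Data.Rational.Unnormalised.Base as ℚᵘ using (mkℚᵘ; *≡*; *≤*)
import Data.Rational.Unnormalised.Properties as ℚᵘ
open import Algebra.Definitions.RawSemiring ℚ.+-*-rawSemiring using () renaming (_^_ to _^ℚ_)
open import Data.Fin.Base as Fin using (Fin; toℕ; fromℕ<)
open import Data.Fin.Properties as Fin using (toℕ-fromℕ<; toℕ<n; all?)
open import Data.Vec.Base using (lookup; _∷_; [])
open import Data.Product.Base using (_,_; proj₁; proj₂; map₂)
open import Data.Sum.Base using (inj₁; inj₂)
open import Relation.Nullary using (¬_; yes; no; contradiction)
open import Relation.Nullary.Decidable using (toWitness; _×-dec_; _→-dec_)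
open import Relation.Binary.PropositionalEquality
open import Data.Unit using (tt)

-- Remainders, powers and increasing sequences

-- Modulo m the number `x * m-1` is the negative of x, so adding it to both sides cancels x without
-- leaving ℕ.
+-cancelˡ-% : ∀ x a b m .{{_ : NonZero m}} → (x + a) % m ≡ (x + b) % m → a % m ≡ b % m
+-cancelˡ-% x a b m@(suc m-1) eq = begin
  a % m                          ≡⟨ shift a ⟩
  ((x + a) % m + z % m) % m      ≡⟨ cong (λ h → (h + z % m) % m) eq ⟩
  ((x + b) % m + z % m) % m      ≡⟨ shift b ⟨
  b % m                          ∎
  where
  open ≡-Reasoning
  z = x * m-1
  rearrange : ∀ x a k → a + x * suc k ≡ x + a + x * k
  rearrange = solve-∀
  shift : ∀ a → a % m ≡ ((x + a) % m + z % m) % m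
  shift a = begin
    a % m                      ≡⟨ [m+kn]%n≡m%n a x m ⟨
    (a + x * m) % m            ≡⟨ cong (_% m) (rearrange x a m-1) ⟩
    (x + a + z) % m            ≡⟨ %-distribˡ-+ (x + a) z m ⟩
    ((x + a) % m + z % m) % m  ∎

r+q*m-injective : ∀ {m r r′} q q′ .{{_ : NonZero m}} → r ℕ.< m → r′ ℕ.< m →
                  r + q * m ≡ r′ + q′ * m → r ≡ r′ × q ≡ q′
r+q*m-injective {m} {r} {r′} q q′ r<m r′<m eq =
  r≡r′ , ℕ.*-cancelʳ-≡ q q′ m (ℕ.+-cancelˡ-≡ r _ _ (trans eq (cong (_+ q′ * m) (sym r≡r′))))
  where
  open ≡-Reasoning
  r≡r′ : r ≡ r′
  r≡r′ = begin
    r                  ≡⟨ m<n⇒m%n≡m r<m ⟨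
    r % m              ≡⟨ [m+kn]%n≡m%n r q m ⟨
    (r + q * m) % m    ≡⟨ cong (_% m) eq ⟩
    (r′ + q′ * m) % m  ≡⟨ [m+kn]%n≡m%n r′ q′ m ⟩
    r′ % m             ≡⟨ m<n⇒m%n≡m r′<m ⟩
    r′                 ∎

r+q*m<n*m : ∀ {m r q n} → r ℕ.< m → q ℕ.< n → r + q * m ℕ.< n * m
r+q*m<n*m {m} {q = q} r<m q<n =
  ℕ.<-≤-trans (ℕ.+-monoˡ-< (q * m) r<m) (ℕ.*-monoˡ-≤ m q<n)

%-/-injective : ∀ {u v} w .{{_ : NonZero w}} → u mod w ≡ v mod w → u / w ≡ v / w → u ≡ v
%-/-injective {u} {v} w mod≡ /≡ = begin
  u                  ≡⟨ m≡m%n+[m/n]*n u w ⟩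
  u % w + u / w * w  ≡⟨ cong₂ (λ r q → r + q * w) %≡ /≡ ⟩
  v % w + v / w * w  ≡⟨ m≡m%n+[m/n]*n v w ⟨
  v                  ∎
  where
  open ≡-Reasoning
  %≡ : u % w ≡ v % w
  %≡ = trans (sym (toℕ-fromℕ< (m%n<n u w))) (trans (cong toℕ mod≡) (toℕ-fromℕ< (m%n<n v w)))

^-distribʳ-* : ∀ m n o → (m * n) ^ o ≡ m ^ o * n ^ o
^-distribʳ-* m n zero    = refl
^-distribʳ-* m n (suc o) =
  trans (cong (m * n *_) (^-distribʳ-* m n o)) (ℕ.[m*n]*[o*p]≡[m*o]*[n*p] m n (m ^ o) (n ^ o))

m≤m^n : ∀ m n .{{_ : NonZero m}} .{{_ : NonZero n}} → m ≤ m ^ n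
m≤m^n m (suc n) = ℕ.m≤m*n m (m ^ n) {{ℕ.m^n≢0 m n}}

increasing⇒n≤g[n] : ∀ (g : ℕ → ℕ) → (∀ n → g n ℕ.< g (suc n)) → ∀ n → n ≤ g n
increasing⇒n≤g[n] g inc zero    = z≤n
increasing⇒n≤g[n] g inc (suc n) = ℕ.≤-<-trans (increasing⇒n≤g[n] g inc n) (inc n)

-- The search descends from k and stops at the first n with `g n ≤ c`; the index just above n was
-- rejected, which gives `c < g (suc n)`.
bracket : ∀ (g : ℕ → ℕ) {c} → g 0 ≤ c → ∀ k → c ℕ.< g k → ∃[ n ] g n ≤ c × c ℕ.< g (suc n)
bracket g g0≤c zero    c<gk = contradiction c<gk (ℕ.≤⇒≯ g0≤c)
bracket g {c} g0≤c (suc k) c<gk with g k ℕ.≤? c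
... | yes gk≤c = k , gk≤c , c<gk
... | no  gk≰c = bracket g g0≤c k (ℕ.≰⇒> gk≰c)

-- The lexicographic colouring

-- The case i = j says that m ∣ k² only if m ∣ k, so the condition also makes m squarefree once w ≥
-- 1.
SquareDifferenceFreeMod : ∀ m .{{_ : NonZero m}} {w} → (Fin w → ℕ) → Set
SquareDifferenceFreeMod m R =
  ∀ i j k → R i % m ≡ (k * k + R j) % m → i ≡ j × k % m ≡ 0

module LexicographicColoring
  (m w : ℕ) {{m≢0 : NonZero m}} {{w≢0 : NonZero w}}
  (R : Fin w → ℕ) (R-free : SquareDifferenceFreeMod m R) (w<m : w ℕ.< m) where

  private instance
    m*m≢0 : NonZero (m * m)
    m*m≢0 = ℕ.m*n≢0 m m

  -- Level n is meant for x below `(m * m) ^ n`; at level 0 this is a single point. The pair (a,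
  -- residue) is packed into one number with remainder the residue and quotient a modulo m.
  colour : ℕ → ℕ → ℕ
  colour zero    x = 0
  colour (suc n) x = (x + R (u mod w)) % m + u / w * m
    where u = colour n (x / (m * m))

  -- From u < b follows u / w ≤ b / w, so a takes at most `suc (b / w)` values, each combined with m
  -- residues.
  palette : ℕ → ℕ
  palette zero    = 1
  palette (suc n) = suc (palette n / w) * m

  colour<palette : ∀ n x → colour n x ℕ.< palette n
  colour<palette zero    x = s≤s z≤n
  colour<palette (suc n) x =
    r+q*m<n*m (m%n<n (x + R (u mod w)) m)
              (s≤s (/-monoˡ-≤ w (ℕ.<⇒≤ (colour<palette n (x / (m * m))))))
    where u = colour n (x / (m * m))

  -- The conclusion is k ≡ 0 rather than a negation, so that the induction hypothesis for k / m
  -- passes back to k through k = (k / m) m.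
  colour-square-free : ∀ n x k → x + k * k ℕ.< (m * m) ^ n →
                       colour n x ≡ colour n (x + k * k) → k ≡ 0
  colour-square-free zero x k lt _ =
    k*k<1 k (ℕ.≤-<-trans (ℕ.m≤n+m (k * k) x) lt)
    where
    k*k<1 : ∀ k → k * k ℕ.< 1 → k ≡ 0
    k*k<1 zero    _        = refl
    k*k<1 (suc k) (s≤s ())
  colour-square-free (suc n) x k lt eq = trans k≡l*m (cong (_* m) l≡0)
    where
    open ≡-Reasoning
    y  = x / (m * m)
    u  = colour n y
    u′ = colour n ((x + k * k) / (m * m))
    l  = k / m

    components : (x + R (u mod w)) % m ≡ (x + k * k + R (u′ mod w)) % m × u / w ≡ u′ / w
    components = r+q*m-injective (u / w) (u′ / w) (m%n<n _ m) (m%n<n _ m) eq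

    residues : u mod w ≡ u′ mod w × k % m ≡ 0
    residues = R-free (u mod w) (u′ mod w) k
      (+-cancelˡ-% x (R (u mod w)) (k * k + R (u′ mod w)) m
        (trans (proj₁ components) (cong (_% m) (ℕ.+-assoc x (k * k) (R (u′ mod w))))))

    k≡l*m : k ≡ l * m
    k≡l*m = trans (m≡m%n+[m/n]*n k m) (cong (_+ l * m) (proj₂ residues))

    k*k≡l*l*[m*m] : k * k ≡ l * l * (m * m)
    k*k≡l*l*[m*m] = trans (cong₂ _*_ k≡l*m k≡l*m) (ℕ.[m*n]*[o*p]≡[m*o]*[n*p] l m l m)

    -- As m² ∣ k², adding k² causes no carry and shifts the quotient by exactly l².
    quotient : (x + k * k) / (m * m) ≡ y + l * l
    quotient = begin
      (x + k * k) / (m * m)                    ≡⟨ cong (λ h → (x + h) / (m * m)) k*k≡l*l*[m*m] ⟩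
      (x + l * l * (m * m)) / (m * m)          ≡⟨ +-distrib-/-∣ʳ x (divides (l * l) refl) ⟩
      y + l * l * (m * m) / (m * m)            ≡⟨ cong (_+_ y) (m*n/n≡m (l * l) (m * m)) ⟩
      y + l * l                                ∎

    u≡u′ : colour n y ≡ colour n (y + l * l)
    u≡u′ = trans (%-/-injective w (proj₁ residues) (proj₂ components)) (cong (colour n) quotient)

    l≡0 : l ≡ 0
    l≡0 = colour-square-free n y l
      (subst (ℕ._< (m * m) ^ n) quotient
        (m<n*o⇒m/o<n (subst (x + k * k ℕ.<_) (ℕ.*-comm (m * m) ((m * m) ^ n)) lt)))
      u≡u′

  -- Growth of the number of colours

  palette-increasing : ∀ n → palette n ℕ.< palette (suc n)
  palette-increasing n = begin-strict
    b                  ≡⟨ m≡m%n+[m/n]*n b w ⟩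
    b % w + b / w * w  <⟨ ℕ.+-monoˡ-< (b / w * w) (m%n<n b w) ⟩
    suc (b / w) * w    ≤⟨ ℕ.*-monoʳ-≤ (suc (b / w)) (ℕ.<⇒≤ w<m) ⟩
    suc (b / w) * m    ∎
    where
    open ℕ.≤-Reasoning
    b = palette n

  -- The recursion gives w (bₙ₊₁ + d) ≤ m (bₙ + d) as soon as (m − w) d ≥ m w.
  w^n*palette : ∀ n → w ^ n * (palette n + m * w) ≤ suc (m * w) * m ^ n
  w^n*palette zero    = ℕ.≤-reflexive (trans (ℕ.+-identityʳ _) (sym (ℕ.*-identityʳ _)))
  w^n*palette (suc n) = begin
    w * w ^ n * (suc (b / w) * m + m * w)    ≡⟨ swap₁ w (w ^ n) (b / w) m ⟩
    w ^ n * (m * (b / w * w + suc w * w))    ≤⟨ ℕ.*-monoʳ-≤ (w ^ n) (ℕ.*-monoʳ-≤ m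
                                                 (ℕ.+-mono-≤ (m/n*n≤m b w) (ℕ.*-monoˡ-≤ w w<m))) ⟩
    w ^ n * (m * (b + m * w))                ≡⟨ swap₂ (w ^ n) m (b + m * w) ⟩
    m * (w ^ n * (b + m * w))                ≤⟨ ℕ.*-monoʳ-≤ m (w^n*palette n) ⟩
    m * (suc (m * w) * m ^ n)                ≡⟨ swap₂ m (suc (m * w)) (m ^ n) ⟩
    suc (m * w) * (m * m ^ n)                ∎
    where
    open ℕ.≤-Reasoning
    b = palette n
    swap₁ : ∀ w p a m → w * p * (suc a * m + m * w) ≡ p * (m * (a * w + suc w * w))
    swap₁ = solve-∀
    swap₂ : ∀ a b c → a * (b * c) ≡ b * (a * c)
    swap₂ = solve-∀

  -- The lower bound for f in natural numbers

  restricted-colouring : ∀ {N c} n → palette n ≤ c → Coloring N c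
  restricted-colouring n b≤c x = fromℕ< (ℕ.<-≤-trans (colour<palette n (toℕ x)) b≤c)

  restricted-colouring-free : ∀ {N c} n (b≤c : palette n ≤ c) → N ≤ (m * m) ^ n →
    ¬ HasMonochromaticSquareDifference (restricted-colouring {N} n b≤c)
  restricted-colouring-free n b≤c N≤ (x , y , x<y , χx≡χy , k , y-x≡k*k) =
    ℕ.<-irrefl (sym (trans y≡x+l*l (trans (cong (λ h → toℕ x + h * h) l≡0) (ℕ.+-identityʳ _)))) x<y
    where
    open ≡-Reasoning
    -- The root k may be negative; its absolute value has the same square.
    l = ℤ.∣ k ∣
    y≡x+l*l : toℕ y ≡ toℕ x + l * l
    y≡x+l*l = begin
      toℕ y                            ≡⟨ ℕ.m+[n∸m]≡n (ℕ.<⇒≤ x<y) ⟨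
      toℕ x + (toℕ y ℕ.∸ toℕ x)        ≡⟨ cong (λ z → toℕ x + ℤ.∣ z ∣) (ℤ.⊖-≥ (ℕ.<⇒≤ x<y)) ⟨
      toℕ x + ℤ.∣ toℕ y ℤ.⊖ toℕ x ∣    ≡⟨ cong (λ z → toℕ x + ℤ.∣ z ∣) (ℤ.m-n≡m⊖n (toℕ y) (toℕ x)) ⟨
      toℕ x + ℤ.∣ + toℕ y ℤ.- + toℕ x ∣ ≡⟨ cong (λ z → toℕ x + ℤ.∣ z ∣) y-x≡k*k ⟩
      toℕ x + ℤ.∣ k ℤ.* k ∣            ≡⟨ cong (_+_ (toℕ x)) (ℤ.abs-* k k) ⟩
      toℕ x + l * l                    ∎
    colours : colour n (toℕ x) ≡ colour n (toℕ y)
    colours = trans (sym (toℕ-fromℕ< _)) (trans (cong toℕ χx≡χy) (toℕ-fromℕ< _))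
    l≡0 : l ≡ 0
    l≡0 = colour-square-free n (toℕ x) l
      (subst (ℕ._< (m * m) ^ n) y≡x+l*l (ℕ.<-≤-trans (toℕ<n y) N≤))
      (trans colours (cong (colour n) y≡x+l*l))

  -- Otherwise the level n colouring, restricted to the first `f c` points, would be a c-colouring
  -- without a monochromatic square difference.
  [m*m]^n<f : ∀ {f} → ForcesSquareDifference f → ∀ c .{{_ : NonZero c}} n →
              palette n ≤ c → (m * m) ^ n ℕ.< f c
  [m*m]^n<f {f} forces c n b≤c with f c ℕ.≤? (m * m) ^ n
  ... | no  fc≰ = ℕ.≰⇒> fc≰
  ... | yes fc≤ =
    contradiction (forces c (restricted-colouring n b≤c)) (restricted-colouring-free n b≤c fc≤)

  -- This becomes 1/C. The power comes from the constant in `w^n*palette`, the factor `m * m` from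
  -- the gap between levels n and n + 1.
  scale : ℕ → ℕ
  scale p = suc (m * w) ^ p * (m * m)

  -- With c between the palettes of levels n and n + 1, c is at most a constant times (m/w)ⁿ⁺¹, and
  -- (m/w)ᵖ ≤ (m²)^q turns its p-th power into the q-th power of m²ⁿ < f c. Multiplying by `W`
  -- clears the denominators.
  c^p≤[scale*f]^q : ∀ {f} → ForcesSquareDifference f →
    ∀ p q .{{_ : NonZero q}} → m ^ p ≤ (m * m) ^ q * w ^ p →
    ∀ c .{{_ : NonZero c}} → c ^ p ≤ (scale p * f c) ^ q
  c^p≤[scale*f]^q {f} forces p q m^p≤ c with
    -- Here `palette 0` is 1 ≤ c, and strict growth gives c < `palette (suc c)`.
    bracket palette (ℕ.>-nonZero⁻¹ c) (suc c) (increasing⇒n≤g[n] palette palette-increasing (suc c))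
  ... | n , b≤c , c<b = ℕ.*-cancelʳ-≤ (c ^ p) _ W {{ℕ.m^n≢0 (w ^ p) (suc n) {{ℕ.m^n≢0 w p}}}} (begin
    c ^ p * W                                ≡⟨ cong (c ^ p *_) (^-^-comm w p (suc n)) ⟩
    c ^ p * (w ^ suc n) ^ p                  ≡⟨ ^-distribʳ-* c (w ^ suc n) p ⟨
    (c * w ^ suc n) ^ p                      ≤⟨ ℕ.^-monoˡ-≤ p c*w^≤ ⟩
    (A * m ^ suc n) ^ p                      ≡⟨ ^-distribʳ-* A (m ^ suc n) p ⟩
    A ^ p * (m ^ suc n) ^ p                  ≡⟨ cong (A ^ p *_) (^-^-comm m p (suc n)) ⟨
    -- Enlarging `A ^ p` to its q-th power is wasteful but lets the constant enter under the common
    -- exponent q.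
    A ^ p * (m ^ p) ^ suc n                  ≤⟨ ℕ.*-mono-≤ (m≤m^n (A ^ p) q {{ℕ.m^n≢0 A p}})
                                                           (ℕ.^-monoˡ-≤ (suc n) m^p≤) ⟩
    (A ^ p) ^ q * ((m * m) ^ q * w ^ p) ^ suc n
      ≡⟨ cong ((A ^ p) ^ q *_) (^-distribʳ-* ((m * m) ^ q) (w ^ p) (suc n)) ⟩
    (A ^ p) ^ q * (((m * m) ^ q) ^ suc n * W)
      ≡⟨ cong (λ h → (A ^ p) ^ q * (h * W)) (^-^-comm (m * m) q (suc n)) ⟩
    (A ^ p) ^ q * (((m * m) ^ suc n) ^ q * W) ≡⟨ ℕ.*-assoc ((A ^ p) ^ q) _ W ⟨
    (A ^ p) ^ q * ((m * m) ^ suc n) ^ q * W  ≡⟨ cong (_* W) (^-distribʳ-* (A ^ p) _ q) ⟨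
    (A ^ p * (m * m * (m * m) ^ n)) ^ q * W  ≡⟨ cong (λ h → h ^ q * W) (ℕ.*-assoc (A ^ p) (m * m) _) ⟨
    (scale p * (m * m) ^ n) ^ q * W
      ≤⟨ ℕ.*-monoˡ-≤ W (ℕ.^-monoˡ-≤ q (ℕ.*-monoʳ-≤ (scale p) (ℕ.<⇒≤ ([m*m]^n<f forces c n b≤c)))) ⟩
    (scale p * f c) ^ q * W                  ∎)
    where
    open ℕ.≤-Reasoning
    A = suc (m * w)
    W = (w ^ p) ^ suc n
    ^-^-comm : ∀ a i j → (a ^ i) ^ j ≡ (a ^ j) ^ i
    ^-^-comm a i j = trans (ℕ.^-*-assoc a i j) (trans (cong (a ^_) (ℕ.*-comm i j)) (sym (ℕ.^-*-assoc a j i)))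
    c*w^≤ : c * w ^ suc n ≤ A * m ^ suc n
    c*w^≤ = begin
      c * w ^ suc n                          ≡⟨ ℕ.*-comm c (w ^ suc n) ⟩
      w ^ suc n * c                          ≤⟨ ℕ.*-monoʳ-≤ (w ^ suc n)
                                                  (ℕ.≤-trans (ℕ.<⇒≤ c<b) (ℕ.m≤m+n (palette (suc n)) (m * w))) ⟩
      w ^ suc n * (palette (suc n) + m * w)  ≤⟨ w^n*palette (suc n) ⟩
      A * m ^ suc n                          ∎

-- Rational numbers and the cut of a fractional power

toℚᵘ-fromℕ : ∀ n → ℚ.toℚᵘ (fromℕ n) ℚᵘ.≃ mkℚᵘ (+ n) 0
toℚᵘ-fromℕ n = ℚ.toℚᵘ-fromℚᵘ (mkℚᵘ (+ n) 0)

fromℕ-mono-≤ : ∀ {m n} → m ≤ n → fromℕ m ℚ.≤ fromℕ n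
fromℕ-mono-≤ {m} {n} m≤n = ℚ.toℚᵘ-cancel-≤ (begin
  ℚ.toℚᵘ (fromℕ m)  ≃⟨ toℚᵘ-fromℕ m ⟩
  mkℚᵘ (+ m) 0      ≤⟨ *≤* (ℤ.*-monoʳ-≤-nonNeg (+ 1) (ℤ.+≤+ m≤n)) ⟩
  mkℚᵘ (+ n) 0      ≃⟨ toℚᵘ-fromℕ n ⟨
  ℚ.toℚᵘ (fromℕ n)  ∎)
  where open ℚᵘ.≤-Reasoning

fromℕ-* : ∀ m n → fromℕ (m * n) ≡ fromℕ m ℚ.* fromℕ n
fromℕ-* m n = ℚ.toℚᵘ-injective (begin
  ℚ.toℚᵘ (fromℕ (m * n))                  ≈⟨ toℚᵘ-fromℕ (m * n) ⟩
  mkℚᵘ (+ (m * n)) 0                      ≈⟨ *≡* (cong (ℤ._* + 1) (ℤ.pos-* m n)) ⟩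
  mkℚᵘ (+ m) 0 ℚᵘ.* mkℚᵘ (+ n) 0          ≈⟨ ℚᵘ.*-cong (toℚᵘ-fromℕ m) (toℚᵘ-fromℕ n) ⟨
  ℚ.toℚᵘ (fromℕ m) ℚᵘ.* ℚ.toℚᵘ (fromℕ n)  ≈⟨ ℚ.toℚᵘ-homo-* (fromℕ m) (fromℕ n) ⟨
  ℚ.toℚᵘ (fromℕ m ℚ.* fromℕ n)            ∎)
  where open import Relation.Binary.Reasoning.Setoid ℚᵘ.≃-setoid

fromℕ-^ : ∀ n q → fromℕ (n ^ q) ≡ fromℕ n ^ℚ q
fromℕ-^ n zero    = refl
fromℕ-^ n (suc q) = trans (fromℕ-* n (n ^ q)) (cong (fromℕ n ℚ.*_) (fromℕ-^ n q))

^ℚ-nonNeg : ∀ {s} q → 0ℚ ℚ.≤ s → 0ℚ ℚ.≤ s ^ℚ q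
^ℚ-nonNeg     zero    0≤s = ℚ.nonNegative⁻¹ (fromℕ 1)
^ℚ-nonNeg {s} (suc q) 0≤s = ℚ.nonNegative⁻¹ (s ℚ.* s ^ℚ q)
  {{ℚ.nonNeg*nonNeg⇒nonNeg s {{ℚ.nonNegative 0≤s}} (s ^ℚ q) {{ℚ.nonNegative (^ℚ-nonNeg q 0≤s)}}}}

^ℚ-mono-≤ : ∀ {r s} q → 0ℚ ℚ.≤ r → r ℚ.≤ s → r ^ℚ q ℚ.≤ s ^ℚ q
^ℚ-mono-≤         zero    0≤r r≤s = ℚ.≤-refl
^ℚ-mono-≤ {r} {s} (suc q) 0≤r r≤s = begin
  r ℚ.* r ^ℚ q  ≤⟨ ℚ.*-monoˡ-≤-nonNeg r {{ℚ.nonNegative 0≤r}} (^ℚ-mono-≤ q 0≤r r≤s) ⟩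
  r ℚ.* s ^ℚ q  ≤⟨ ℚ.*-monoʳ-≤-nonNeg (s ^ℚ q) {{ℚ.nonNegative (^ℚ-nonNeg q (ℚ.≤-trans 0≤r r≤s))}} r≤s ⟩
  s ℚ.* s ^ℚ q  ∎
  where open ℚ.≤-Reasoning

-- If s ≤ r, then r is nonnegative as well and monotonicity of the power gives the opposite
-- inequality.
^ℚ-cancel-< : ∀ {r s} q → 0ℚ ℚ.≤ s → r ^ℚ q ℚ.< s ^ℚ q → r ℚ.< s
^ℚ-cancel-< {r} {s} q 0≤s r^q<s^q with s ℚ.≤? r
... | yes s≤r = contradiction (ℚ.<-≤-trans r^q<s^q (^ℚ-mono-≤ q 0≤s s≤r)) (ℚ.<-irrefl refl)
... | no  s≰r = ℚ.≰⇒> s≰r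

reciprocal : ∀ L .{{_ : NonZero L}} → ℚ
reciprocal L = + 1 ℚ./ L

reciprocal-positive : ∀ L .{{_ : NonZero L}} → ℚ.Positive (reciprocal L)
reciprocal-positive L = ℚ.normalize-pos 1 L

reciprocal-*-fromℕ : ∀ L n .{{_ : NonZero L}} → reciprocal L ℚ.* fromℕ (L * n) ≡ fromℕ n
reciprocal-*-fromℕ L@(suc L-1) n = ℚ.toℚᵘ-injective (begin
  ℚ.toℚᵘ (reciprocal L ℚ.* fromℕ (L * n))            ≈⟨ ℚ.toℚᵘ-homo-* (reciprocal L) (fromℕ (L * n)) ⟩
  ℚ.toℚᵘ (reciprocal L) ℚᵘ.* ℚ.toℚᵘ (fromℕ (L * n))  ≈⟨ ℚᵘ.*-cong (ℚ.toℚᵘ-fromℚᵘ (mkℚᵘ (+ 1) L-1)) (toℚᵘ-fromℕ (L * n)) ⟩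
  mkℚᵘ (+ 1) L-1 ℚᵘ.* mkℚᵘ (+ (L * n)) 0             ≈⟨ *≡* cross ⟩
  mkℚᵘ (+ n) 0                                       ≈⟨ toℚᵘ-fromℕ n ⟨
  ℚ.toℚᵘ (fromℕ n)                                   ∎)
  where
  open import Relation.Binary.Reasoning.Setoid ℚᵘ.≃-setoid
  rearrange : ∀ a b → 1 * (a * b) * 1 ≡ b * (a * 1)
  rearrange = solve-∀
  cross : + 1 ℤ.* + (L * n) ℤ.* + 1 ≡ + n ℤ.* + (L * 1)
  cross = trans (cong (ℤ._* + 1) (sym (ℤ.pos-* 1 (L * n))))
    (trans (sym (ℤ.pos-* (1 * (L * n)) 1)) (trans (cong +_ (rearrange L n)) (ℤ.pos-* n (L * 1))))

-- Each r in the cut is at most L n: it is negative, or r^q < c^p ≤ (L n)^q. Dividing by L gives the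
-- bound.
≥-reciprocal· : ∀ L .{{_ : NonZero L}} c n p q .{{_ : NonZero q}} →
                c ^ p ≤ (L * n) ^ q → fromℕ n ≥ reciprocal L · (c ^[ p / q ])
≥-reciprocal· L c n p q c^p≤ r r∈cut = begin
  reciprocal L ℚ.* r              ≤⟨ ℚ.*-monoˡ-≤-nonNeg (reciprocal L)
                                       {{ℚ.pos⇒nonNeg (reciprocal L) {{reciprocal-positive L}}}} (r≤ r∈cut) ⟩
  reciprocal L ℚ.* fromℕ (L * n)  ≡⟨ reciprocal-*-fromℕ L n ⟩
  fromℕ n                         ∎
  where
  open ℚ.≤-Reasoning
  0≤s : 0ℚ ℚ.≤ fromℕ (L * n)
  0≤s = fromℕ-mono-≤ {0} {L * n} z≤n
  r≤ : (c ^[ p / q ]) r → r ℚ.≤ fromℕ (L * n)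
  r≤ (inj₁ r<0)     = ℚ.≤-trans (ℚ.<⇒≤ r<0) 0≤s
  r≤ (inj₂ r^q<c^p) = ℚ.<⇒≤ (^ℚ-cancel-< q 0≤s
    (subst (r ^ℚ q ℚ.<_) (fromℕ-^ (L * n) q) (ℚ.<-≤-trans r^q<c^p (fromℕ-mono-≤ c^p≤))))

-- The residues modulo 205 and the exponent 15/4

-- Found by a computer search for cliques.
residues₂₀₅ : Fin 12 → ℕ
residues₂₀₅ = lookup (0 ∷ 2 ∷ 8 ∷ 14 ∷ 77 ∷ 79 ∷ 85 ∷ 96 ∷ 103 ∷ 109 ∷ 111 ∷ 181 ∷ [])

-- A check of 12 · 12 · 205 cases by evaluation.
residues₂₀₅-free-digits : ∀ i j (k : Fin 205) →
  residues₂₀₅ i % 205 ≡ (toℕ k * toℕ k + residues₂₀₅ j) % 205 → i ≡ j × toℕ k ≡ 0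
residues₂₀₅-free-digits = toWitness {a? = all? λ i → all? λ j → all? λ k →
  (residues₂₀₅ i % 205 ℕ.≟ (toℕ k * toℕ k + residues₂₀₅ j) % 205)
  →-dec ((i Fin.≟ j) ×-dec (toℕ k ℕ.≟ 0))} tt

-- Modulo 205, k² depends only on k modulo 205, which reduces every k to the finite check.
residues₂₀₅-free : SquareDifferenceFreeMod 205 residues₂₀₅
residues₂₀₅-free i j k eq =
  map₂ (trans (sym toℕ-k̂))
    (residues₂₀₅-free-digits i j k̂
      (trans eq (trans reduce (cong (λ h → (h * h + s) % 205) (sym toℕ-k̂)))))
  where
  open ≡-Reasoning
  k̂ = fromℕ< (m%n<n k 205)
  toℕ-k̂ : toℕ k̂ ≡ k % 205
  toℕ-k̂ = toℕ-fromℕ< (m%n<n k 205)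
  s = residues₂₀₅ j
  reduce : (k * k + s) % 205 ≡ (k % 205 * (k % 205) + s) % 205
  reduce = begin
    (k * k + s) % 205                                ≡⟨ %-distribˡ-+ (k * k) s 205 ⟩
    (k * k % 205 + s % 205) % 205                    ≡⟨ cong (λ h → (h + s % 205) % 205) (%-distribˡ-* k k 205) ⟩
    (k % 205 * (k % 205) % 205 + s % 205) % 205      ≡⟨ %-distribˡ-+ (k % 205 * (k % 205)) s 205 ⟨
    (k % 205 * (k % 205) + s) % 205                  ∎

theorem4p5 : (f : ℕ → ℕ) → ForcesSquareDifference f →
    ∃[ C ] 0ℚ < C × ∃[ c₀ ] (∀ c → c₀ ≤ c → fromℕ (f c) ≥ C · (c ^[ 15 / 4 ]))
theorem4p5 f forces =
  reciprocal (scale 15) , ℚ.positive⁻¹ (reciprocal (scale 15)) {{reciprocal-positive (scale 15)}} ,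
  1 , λ c 1≤c → ≥-reciprocal· (scale 15) c (f c) 15 4
    -- The numerical condition is 205⁷ ≤ 12¹⁵ multiplied by 205⁸.
    (c^p≤[scale*f]^q forces 15 4 (ℕ.≤ᵇ⇒≤ (205 ^ 15) ((205 * 205) ^ 4 * 12 ^ 15) tt) c {{ℕ.>-nonZero 1≤c}})
  where open LexicographicColoring 205 12 residues₂₀₅ residues₂₀₅-free (ℕ.≤ᵇ⇒≤ 13 205 tt)
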